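{- For each $N$ and $n$ there exists $f(n,N)\in\mathbb{N}$ such that whenever $\mathbb{A}$ is an $n$-permutable relational structure and $I$ is an unsatisfiable path instance of $\mathrm{CSP}(\mathbb{A})$ with $|B_i|\le N$ for all $i$, then $\mathcal{S}^{f(n,N)}_{\mathbb{A}}(I)\vdash G$.
   Context: A relational structure $\mathbb{A}=(A,\mathcal{R})$ is a finite set $A$ with finitely many basic relations of positive finite arity. $\mathbb{A}$ is $n$-permutable if it has polymorphisms (operations on $A$ preserving all basic relations) $p_0,\dots,p_n$, ternary, with $p_0(x,y,z)=x$, $p_i(x,x,y)=p_{i+1}(x,y,y)$ for $i=0,\dots,n-1$, and $p_n(x,y,z)=z$. A path instance of $\mathrm{CSP}(\mathbb{A})$ of length $\ell$ has variables $[\ell]$, exactly one unary constraint on each $i$ with basic relation $B_i\subseteq A$, exactly one binary constraint on each $(i,i+1)$, $i<\ell$, with basic relation $B_{i,i+1}$, and no other constraints; a solution is $s\colon[\ell]\to A$ with $s(i)\in B_i$ and $(s(i),s(i+1))\in B_{i,i+1}$. The $r$-ary maximal symmetric Datalog program $\mathcal{S}^r_{\mathbb{A}}$: IDB predicates are all relations on $A$ of arity at most $r$, plus a non-IDB symbol for each basic relation of $\mathbb{A}$ of arity at most $r$. Rules $R(\rho)\leftarrow S_1(\sigma_1),\dots,S_\ell(\sigma_\ell)$ are all rules that (1) have an IDB on the left and at most one IDB on the right, (2) use only variables from $\{x_1,\dots,x_r\}$, (3) have no repeated atom on the right, (4) are consistent with $\mathbb{A}$: for every $f\colon\{x_1,\dots,x_r\}\to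 A$, if $f(\sigma_i)\in S_i$ for all $i$ then $f(\rho)\in R$, and (5) if the right side contains an IDB atom, the rule with the left atom and that right IDB atom exchanged is also consistent. Goal predicates: empty relations of arity at most $r$. Derivation on an instance $I=(V,\mathcal C)$: $\mathcal{S}^r_{\mathbb{A}}(I)\vdash R(\rho)$ if $(\rho,R)\in\mathcal C$, or there is a rule $R(\tau)\leftarrow S_1(\sigma_1),\dots,S_\ell(\sigma_\ell)$ and a map $\omega$ from program variables to $V$ with $\omega(\tau)=\rho$ and $\mathcal{S}^r_{\mathbb{A}}(I)\vdash S_i(\omega(\sigma_i))$ for all $i$; $\vdash G$ means some goal predicate is derived on some tuple. -}

module Defs where

open import Data.Nat using (ℕ; zero; suc; _≤_)
open import Data.Bool using (Bool; true; false)
open import Data.Fin using (Fin; inject₁; fromℕ) renaming (zero to fzero; suc to fsuc)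
open import Data.Vec using (Vec; []; _∷_; map; tabulate; lookup; toList; countᵇ; allFin)
open import Data.List using (List; []; _∷_)
open import Data.Maybe using (Maybe; just; nothing)
open import Data.Product using (Σ; _×_; _,_)
open import Data.List.Relation.Unary.All using (All)
open import Data.List.Relation.Unary.AllPairs using (AllPairs)
import Data.Maybe.Relation.Unary.All as MaybeAll
open import Relation.Binary.PropositionalEquality using (_≡_; _≢_; subst; sym)
open import Relation.Nullary using (¬_)

Rel : ℕ → ℕ → Set
Rel k a = Vec (Fin k) a → Bool

record Structure : Set where
  field
    size      : ℕ
    nrel      : ℕ
    arity     : Fin nrel → ℕ
    arity-pos : ∀ j → 1 ≤ arity j
    rel       : (j : Fin nrel) → Rel size (arity j)

module _ (𝔸 : Structure) where
  open Structure 𝔸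

  Ternary : Set
  Ternary = Fin size → Fin size → Fin size → Fin size

  IsPolymorphism : Ternary → Set
  IsPolymorphism p = ∀ (j : Fin nrel) (x y z : Vec (Fin size) (arity j)) →
    rel j x ≡ true → rel j y ≡ true → rel j z ≡ true →
    rel j (tabulate (λ c → p (lookup x c) (lookup y c) (lookup z c))) ≡ true

  NPermutable : ℕ → Set
  NPermutable n = Σ (Fin (suc n) → Ternary) λ p →
      (∀ i → IsPolymorphism (p i))
    × (∀ x y z → p fzero x y z ≡ x)
    × (∀ (i : Fin n) x y → p (inject₁ i) x x y ≡ p (fsuc i) x y y)
    × (∀ x y z → p (fromℕ n) x y z ≡ z)

  -- Path instances of CSP(A).  Variables are Fin (suc m) (ℓ = suc m),
  -- the binary constraint number i sits on (inject₁ i , suc i).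
  record PathInstance : Set where
    field
      m        : ℕ
      unary    : Fin (suc m) → Fin nrel
      unary-ar : ∀ i → arity (unary i) ≡ 1
      binary   : Fin m → Fin nrel
      binary-ar : ∀ i → arity (binary i) ≡ 2

  module _ (P : PathInstance) where
    open PathInstance P

    Var : Set
    Var = Fin (suc m)

    data Con : (j : Fin nrel) → Vec Var (arity j) → Set where
      uCon : (i : Var) (t : Vec Var (arity (unary i))) →
             toList t ≡ i ∷ [] → Con (unary i) t
      bCon : (i : Fin m) (t : Vec Var (arity (binary i))) →
             toList t ≡ inject₁ i ∷ fsuc i ∷ [] → Con (binary i) t

    Solution : (Var → Fin size) → Set
    Solution s = ∀ j t → Con j t → rel j (map s t) ≡ true

    Satisfiable : Set
    Satisfiable = Σ (Var → Fin size) Solution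

    B : Var → Fin size → Bool
    B i a = rel (unary i) (subst (Vec (Fin size)) (sym (unary-ar i)) (a ∷ []))

    card : Var → ℕ
    card i = countᵇ (B i) (allFin size)

  -- The r-ary maximal symmetric Datalog program S^r_A.
  -- Program variables x_1 … x_r are Fin r.
  module Program (r : ℕ) where

    record EAtom : Set where
      constructor eatom
      field
        symb : Fin nrel
        ar≤  : arity symb ≤ r
        args : Vec (Fin r) (arity symb)

    record IAtom : Set where
      constructor iatom
      field
        ar   : ℕ
        ar≤  : ar ≤ r
        R    : Rel size ar
        args : Vec (Fin r) ar

    HoldsE : (Fin r → Fin size) → EAtom → Set
    HoldsE f e = rel (EAtom.symb e) (map f (EAtom.args e)) ≡ true

    HoldsI : (Fin r → Fin size) → IAtom → Set
    HoldsI f a = IAtom.R a (map f (IAtom.args a)) ≡ true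

    record Rule : Set where
      field
        head     : IAtom
        edbs     : List EAtom
        idb      : Maybe IAtom
        distinct : AllPairs _≢_ edbs
        consistent : ∀ (f : Fin r → Fin size) →
          All (HoldsE f) edbs → MaybeAll.All (HoldsI f) idb → HoldsI f head
        symmetric : ∀ S → idb ≡ just S → ∀ (f : Fin r → Fin size) →
          All (HoldsE f) edbs → HoldsI f head → HoldsI f S

    module _ (P : PathInstance) where

      data Derives : (a : ℕ) → Rel size a → Vec (Var P) a → Set where
        byRule : (ρ : Rule) (ω : Fin r → Var P) →
          All (λ e → Con P (EAtom.symb e) (map ω (EAtom.args e))) (Rule.edbs ρ) →
          MaybeAll.All (λ S → Derives (IAtom.ar S) (IAtom.R S) (map ω (IAtom.args S)))
                       (Rule.idb ρ) →
          Derives (IAtom.ar (Rule.head ρ)) (IAtom.R (Rule.head ρ))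
                  (map ω (IAtom.args (Rule.head ρ)))

      DerivesGoal : Set
      DerivesGoal = Σ ℕ λ a → a ≤ r × Σ (Rel size a) λ R →
        (∀ t → R t ≡ false) × Σ (Vec (Var P) a) λ t → Derives a R t

{-# OPTIONS --safe #-}

-- The facts propagated are E_ij(x_i, x_j): "some solution of the subpath from i to j takes these end values".
-- Derivations stack: a derivable fact can be attached to any state, used as an extra
-- constraint, and detached again, at the cost of its width.  Labelling each B_i by Fin N turns E_ij into
-- an N × N Boolean matrix, and by Simon's factorization theorem every subpath is assembled, in boundedly
-- many rounds, from single edges by binary composition and by composition of arbitrarily many subpaths
-- sharing one idempotent matrix e.  In a long enough such chain the Hagemann-Mitschke argument makes e
-- symmetric on its reflexive elements, so e(x_0, x_j) and e(x_0, x_{j+1}) are equivalent modulo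
-- the neighbouring links; hence the far end of the fact slides symmetrically at constant width.
-- Unsatisfiability means that the fact for the whole path is the empty relation.
module Submission where

open import Defs
open import Data.Nat as ℕ using (ℕ; zero; suc; _+_; _*_; _≤_; _<?_; z≤n; s≤s; s≤s⁻¹)
import Data.Nat.Properties as ℕ
open import Data.Bool using (Bool; true; false; _∧_)
import Data.Bool.Properties as Bool
open import Data.Empty using (⊥-elim)
open import Data.Fin as Fin using (Fin; toℕ; fromℕ; fromℕ<; inject₁; inject≤) renaming (zero to fzero; suc to fsuc)
import Data.Fin.Properties as Fin
open import Data.Fin.Induction using (<-weakInduction)
open import Data.List as List using (List; []; _∷_; length; filter; cartesianProductWith)
open import Data.List.Properties using (filter-notAll; length-map)
open import Data.List.Membership.Propositional using (_∈_; find; lose)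
open import Data.List.Membership.Propositional.Properties using (∈-map⁺; ∈-map⁻; ∈-filter⁺; ∈-filter⁻; ∈-cartesianProductWith⁺)
open import Data.List.Relation.Unary.Any as Any using (here; there)
open import Data.List.Relation.Unary.All as All using (All; []; _∷_)
import Data.List.Relation.Unary.All.Properties as All
open import Data.List.Relation.Unary.AllPairs using (AllPairs; []; _∷_)
open import Data.Maybe using (just; nothing)
import Data.Maybe.Relation.Unary.All as MaybeAll
open import Data.Product using (Σ; ∃; _×_; _,_; proj₁; proj₂; swap)
open import Data.Sum using (_⊎_; inj₁; inj₂; [_,_]′; map₂)
open import Data.Vec using (Vec; []; _∷_; _++_; map; lookup; tabulate; toList; allFin; countᵇ)
open import Data.Vec.Properties using (map-∘; map-++; lookup∘tabulate; tabulate∘lookup; tabulate-cong; ≡-dec; toList-injective; cast-is-id)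
open import Data.Vec.Membership.Propositional using () renaming (_∈_ to _∈ᵛ_)
open import Data.Vec.Membership.Propositional.Properties using (∈-++⁺ˡ; ∈-++⁺ʳ; ∈-allFin⁺)
import Data.Vec.Membership.DecPropositional as DecMembership
open import Data.Vec.Relation.Unary.Any using (index; here; there)
open import Data.Vec.Relation.Unary.Any.Properties using (lookup-index)
open import Data.Vec.Relation.Unary.All as VAll using ([]; _∷_)
import Data.Vec.Relation.Unary.All.Properties as VAll
open import Function using (_∘_; id)
open import Relation.Binary using (DecidableEquality; Transitive)
open import Relation.Binary.PropositionalEquality using (_≡_; _≢_; refl; sym; trans; cong; cong₂; subst)
open import Relation.Binary.Construct.Closure.ReflexiveTransitive as Star using (Star; ε; _◅_)
open import Relation.Nullary using (¬_; Dec; yes; no; ¬?; does; contradiction)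
open import Relation.Nullary.Decidable using (_×-dec_; _⊎-dec_; map′; dec-true; dec-false; decidable-stable)

-- Simon's factorization theorem

-- Cuts a word in front of every `R`-link: each block is one `R`-link with the `Q`-links up to the
-- next.
star-split : ∀ {P : Set} {Q R : P → P → Set} {i k} →
  Star (λ x y → Q x y ⊎ R x y) i k →
  ∃ λ j → Star Q i j × Star (λ x y → ∃ λ z → R x z × Star Q z y) j k
star-split ε = _ , ε , ε
star-split (inj₁ q ◅ w) =
  let _ , u , v = star-split w in _ , q ◅ u , v
star-split (inj₂ r ◅ w) =
  let _ , u , v = star-split w in _ , ε , (_ , r , u) ◅ v

star-pairs : ∀ {P : Set} {R : P → P → Set} {i k} → Star R i k →
  ∃ λ j → Star (λ x y → ∃ λ z → R x z × R z y) i j × (j ≡ k ⊎ R j k)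
star-pairs ε = _ , ε , inj₁ refl
star-pairs (r ◅ ε) = _ , ε , inj₂ r
star-pairs (r ◅ s ◅ w) =
  let _ , u , v = star-pairs w in _ , (_ , r , s) ◅ u , v

module FactorizationForest {S : Set} (_≟_ : DecidableEquality S)
  (_·_ : S → S → S) (·-assoc : ∀ x y z → (x · y) · z ≡ x · (y · z))
  (c d : ℕ → ℕ) where

  -- D w i j means that the segment from i to j, whose value is col i j, can be treated at cost w.
  record Model : Set₁ where
    field
      Pt       : Set
      _≼_      : Pt → Pt → Set
      ≼-trans  : Transitive _≼_
      col      : Pt → Pt → S
      col-comp : ∀ {i j k} → i ≼ j → j ≼ k → col i k ≡ col i j · col j k
      D        : ℕ → Pt → Pt → Set
      D⇒≼      : ∀ {w i j} → D w i j → i ≼ j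
      mono     : ∀ {w w' i j} → w ≤ w' → D w i j → D w' i j
      unit     : ∀ {w i} → D w i i
      comp     : ∀ {w i j k} → D w i j → D w j k → D (c w) i k
      idem     : ∀ {w e i k} → e · e ≡ e →
                 Star (λ x y → D w x y × col x y ≡ e) i k → D (d w) i k

    comp₂ : ∀ {v w i j k} → D v i j → D w j k → D (c (v + w)) i k
    comp₂ {v} {w} p q = comp (mono (ℕ.m≤m+n v w) p) (mono (ℕ.m≤n+m w v) q)

    Word : (S → Set) → ℕ → Pt → Pt → Set
    Word L w = Star (λ x y → D w x y × L (col x y))

  -- `ψ` is chosen before the model, so one bound serves all structures and all paths.
  Bounded : (S → Set) → Set₁
  Bounded L = Σ (ℕ → ℕ) λ ψ → (M : Model) →
    ∀ {w i k} → Model.Word M L w i k → Model.D M (ψ w) i k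

  Closed : List S → Set
  Closed T = ∀ {x y} → x ∈ T → y ∈ T → x · y ∈ T

  Inj : List S → S → Set
  Inj T a = ∀ {x y} → x ∈ T → y ∈ T → a · x ≡ a · y → x ≡ y

  Collision : List S → S → Set
  Collision T a = ∃ λ t → ∃ λ u → t ∈ T × u ∈ T × t ≢ u × a · t ≡ a · u

  inj-or-collision : ∀ T a → Inj T a ⊎ Collision T a
  inj-or-collision T a with Any.any? (λ t → Any.any? (λ u → ¬? (t ≟ u) ×-dec (a · t) ≟ (a · u)) T) T
  ... | yes p = let t , t∈ , q = find p
                    u , u∈ , r = find q in inj₂ (t , u , t∈ , u∈ , r)
  ... | no ¬p = inj₁ λ {x} {y} x∈ y∈ eq → decidable-stable (x ≟ y) λ x≢y →
                  ¬p (lose x∈ (lose y∈ (x≢y , eq)))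

  module _ (T : List S) (closed : Closed T) where

    Cancel : S → Set
    Cancel x = x ∈ T × Inj T x

    cancel-· : ∀ {x y} → Cancel x → Cancel y → Cancel (x · y)
    cancel-· {x} {y} (x∈ , ix) (y∈ , iy) = closed x∈ y∈ , λ {s} {t} s∈ t∈ eq →
      iy s∈ t∈ (ix (closed y∈ s∈) (closed y∈ t∈)
        (trans (sym (·-assoc x y s)) (trans eq (·-assoc x y t))))

    -- Words with left-cancellable letters

    module _ (M : Model) where

      open Model M

      -- `T` need not contain an identity, so the empty word is kept apart.
      word-value : ∀ {w i k} → Word (_∈ T) w i k → i ≡ k ⊎ (i ≼ k × col i k ∈ T)
      word-value ε = inj₁ refl
      word-value ((p , t) ◅ ws) with word-value ws
      ... | inj₁ refl = inj₂ (D⇒≼ p , t)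
      ... | inj₂ (le , t') = inj₂ (≼-trans (D⇒≼ p) le ,
              subst (_∈ T) (sym (col-comp (D⇒≼ p) le)) (closed t t'))

      unit-or : ∀ {w j k} → j ≡ k ⊎ D w j k → D w j k
      unit-or (inj₁ refl) = unit
      unit-or (inj₂ p) = p

      -- A link of a cancellable word read from b on, with the value v at its source confined to V.
      Cut : (V : S → Set) → ℕ → Pt → Pt → Pt → Set
      Cut V w b x y = b ≼ x × Cancel (col b x) × V (col b x) × D w x y × Cancel (col x y)

      cuts : ∀ {w b i k} → b ≼ i → Cancel (col b i) → Word Cancel w i k → Star (Cut (_∈ T) w b) i k
      cuts le cx ε = ε
      cuts le cx ((p , cy) ◅ ws) = (le , cx , proj₁ cx , p , cy) ◅
        cuts (≼-trans le (D⇒≼ p)) (subst Cancel (sym (col-comp le (D⇒≼ p))) (cancel-· cx cy)) ws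

      cut-value : ∀ {V v w b x y z} → D v x z → Cancel (col x z) → Star (Cut V w b) z y → col x y ∈ T
      cut-value p (h , _) zs with word-value (Star.map (λ (_ , _ , _ , q , h , _) → q , h) zs)
      ... | inj₁ refl = h
      ... | inj₂ (le , h') = subst (_∈ T) (sym (col-comp (D⇒≼ p) le)) (closed h h')

      Visit : S → ℕ → Pt → Pt → Pt → Set
      Visit v w b x y = b ≼ x × Cancel v × col b x ≡ v × D w x y × col x y ∈ T

      Loop : S → ℕ → Pt → Pt → Set
      Loop v w x y = D w x y × col x y ∈ T × Cancel v × v · col x y ≡ v

      -- A visit ends where the next one starts, hence at prefix value `v` again, which makes it a
      -- loop. The last visit has no successor and is left over.
      visits-loops : ∀ {v w b i k} → Star (Visit v w b) i k → ∃ λ j → Star (Loop v w) i j × (j ≡ k ⊎ D w j k)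
      visits-loops ε = _ , ε , inj₁ refl
      visits-loops ((_ , _ , _ , p , _) ◅ ε) = _ , ε , inj₂ p
      visits-loops ((le , cv , eq , p , t) ◅ vs@((_ , _ , eq' , _) ◅ _)) =
        let _ , xs , r = visits-loops vs in
        _ , (p , t , cv , trans (cong (_· _) (sym eq)) (trans (sym (col-comp le (D⇒≼ p))) eq')) ◅ xs , r

      -- By cancellation v q = v determines q, and v (q q) = v = v q makes it idempotent.
      loops : ∀ {v w i j} → Star (Loop v w) i j → D (d w) i j
      loops ε = unit
      loops xs@((p , t , (v∈ , iv) , eq) ◅ _) = idem
        (iv (closed t t) t (trans (sym (·-assoc _ _ _)) (cong (_· _) eq)))
        (Star.map (λ (p' , t' , _ , eq') → p' , iv t' t (trans eq' (sym eq))) xs)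

      visits : ∀ {v w b i k} → Star (Visit v w b) i k → D (c (d w + w)) i k
      visits vs = let _ , xs , r = visits-loops vs in comp₂ (loops xs) (unit-or r)

    -- Induction on the list of allowed prefix values. After cutting at every point with prefix
    -- value `v`, the words between the cuts only meet prefix values in `V`, and the blocks starting
    -- at the cuts are visits to `v`.
    cuts-bounded : ∀ V → Σ (ℕ → ℕ) λ ψ → (M : Model) →
      ∀ {w b i k} → Star (Cut M (_∈ V) w b) i k → Model.D M (ψ w) i k
    cuts-bounded [] = (λ w → w) , λ where
      M ε → Model.unit M
      M ((_ , _ , () , _) ◅ _)
    cuts-bounded (v ∷ V) = (λ w → c (ψ w + c (d (χ w) + χ w))) , λ M cs →
        let _ , xs , ys = star-split (Star.map (sort M) cs)
        in Model.comp₂ M (rec M xs) (visits M (Star.map (visit M) ys))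
      where
      ψ = proj₁ (cuts-bounded V)
      rec = proj₂ (cuts-bounded V)
      χ : ℕ → ℕ
      χ w = c (w + ψ w)
      sort : ∀ M {w b x y} → Cut M (_∈ v ∷ V) w b x y → Cut M (_∈ V) w b x y ⊎ Cut M (_≡ v) w b x y
      sort M (le , cx , here eq , p) = inj₂ (le , cx , eq , p)
      sort M (le , cx , there h , p) = inj₁ (le , cx , h , p)
      visit : ∀ M {w b x y} → (∃ λ z → Cut M (_≡ v) w b x z × Star (Cut M (_∈ V) w b) z y) → Visit M v (χ w) b x y
      visit M (_ , (le , cx , eq , p , cy) , zs) =
        le , subst Cancel eq cx , eq , Model.comp₂ M p (rec M zs) , cut-value M {V = _∈ V} p cy zs

    -- The first letter is set aside: the value at the empty prefix need not lie in `T`, whereas all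
    -- later prefix values do.
    cancel-bounded : Bounded Cancel
    cancel-bounded =
      let ψ , rec = cuts-bounded T in
      (λ w → c (w + ψ w)) , λ where
        M ε → Model.unit M
        M ((p , h) ◅ ws) → Model.comp₂ M p (rec M (cuts M (Model.D⇒≼ M p) h ws))

    -- `L` lists the letters still allowed to be non-cancellable; induction removes them one at a
    -- time.
    Letter : List S → S → Set
    Letter L x = x ∈ T × (x ∈ L ⊎ Inj T x)

    -- Words with a letter that is not left-cancellable

    module _ (a : S) (a∈ : a ∈ T) (col-a : Collision T a) where

      -- This is `a T`. One colliding element is skipped, since its partner yields the same product;
      -- hence the list is strictly shorter than `T`.
      image : List S
      image = List.map (a ·_) (filter (λ x → ¬? (x ≟ proj₁ col-a)) T)

      image-length : suc (length image) ≤ length T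
      image-length =
        let t , u , t∈ , _ = col-a in
        subst (λ l → suc l ≤ length T) (sym (length-map (a ·_) (filter (λ x → ¬? (x ≟ t)) T)))
          (filter-notAll (λ x → ¬? (x ≟ t)) T (lose t∈ (λ ¬p → ¬p refl)))

      ∈-image⁺ : ∀ {x} → x ∈ T → a · x ∈ image
      ∈-image⁺ {x} x∈ =
        let t , u , t∈ , u∈ , t≢u , eq = col-a in
        go t u u∈ t≢u eq (x ≟ t)
        where
        go : ∀ t u → u ∈ T → t ≢ u → a · t ≡ a · u → Dec (x ≡ t) →
          a · x ∈ List.map (a ·_) (filter (λ y → ¬? (y ≟ t)) T)
        go t u u∈ t≢u eq (yes refl) = subst (_∈ List.map (a ·_) (filter (λ y → ¬? (y ≟ t)) T)) (sym eq)
          (∈-map⁺ (a ·_) (∈-filter⁺ (λ y → ¬? (y ≟ t)) u∈ λ u≡t → t≢u (sym u≡t)))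
        go t u u∈ t≢u eq (no x≢t) = ∈-map⁺ (a ·_) (∈-filter⁺ (λ y → ¬? (y ≟ t)) x∈ x≢t)

      ∈-image⁻ : ∀ {x} → x ∈ image → ∃ λ y → y ∈ T × x ≡ a · y
      ∈-image⁻ x∈ =
        let y , y∈ , eq = ∈-map⁻ (a ·_) x∈ in
        y , proj₁ (∈-filter⁻ (λ x → ¬? (x ≟ proj₁ col-a)) y∈) , eq

      image-closed : Closed image
      image-closed x∈ y∈ =
        let u , u∈ , x≡ = ∈-image⁻ x∈
            v , v∈ , y≡ = ∈-image⁻ y∈ in
        subst (_∈ image) (sym (trans (cong₂ _·_ x≡ y≡) (·-assoc a u (a · v))))
          (∈-image⁺ (closed u∈ (closed a∈ v∈)))

      Block : (M : Model) → ℕ → Model.Pt M → Model.Pt M → Set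
      Block M w x y = D w x y × col x y ∈ T × (col x y ≡ a ⊎ ∃ λ s → s ∈ T × col x y ≡ a · s)
        where open Model M

      -- The blocks a w, with w free of a, have values in a T¹, hence two consecutive ones have value in a T.
      block-pair : ∀ M {w x y} → (∃ λ z → Block M w x z × Block M w z y) →
        Model.D M (c w) x y × Model.col M x y ∈ image
      block-pair M (z , (p , _ , v) , (q , t , _)) =
        comp p q , subst (_∈ image) (sym (col-comp (D⇒≼ p) (D⇒≼ q))) (go v)
        where
        open Model M
        go : ∀ {s} → s ≡ a ⊎ (∃ λ s' → s' ∈ T × s ≡ a · s') → s · col z _ ∈ image
        go (inj₁ refl) = ∈-image⁺ t
        go (inj₂ (_ , h , refl)) = subst (_∈ image) (sym (·-assoc _ _ _)) (∈-image⁺ (closed h t))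

      -- Blocks starting at occurrences of `a` are taken in pairs, because a single block may have
      -- value `a` itself, outside `a T`. `recᵢ` treats the pairs, `recₗ` the words between
      -- occurrences, and at most one block is left over.
      collision-bounded : ∀ {L} → Bounded (_∈ image) → Bounded (Letter L) → Bounded (Letter (a ∷ L))
      collision-bounded {L} (φ , recᵢ) (ψ , recₗ) =
        (λ w → c (ψ w + c (φ (c (χ w)) + χ w))) , λ M ws →
          let _ , xs , ys = star-split (Star.map (sort M) ws)
              _ , us , v = star-pairs (Star.map (block M) ys)
          in Model.comp₂ M (recₗ M xs) (Model.comp₂ M (recᵢ M (Star.map (block-pair M) us)) (unit-or M (map₂ proj₁ v)))
        where
        χ : ℕ → ℕ
        χ w = c (w + ψ w)
        LetterLink : (S → Set) → (M : Model) → ℕ → Model.Pt M → Model.Pt M → Set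
        LetterLink L M w x y = Model.D M w x y × L (Model.col M x y)
        sort : ∀ M {w x y} → LetterLink (Letter (a ∷ L)) M w x y →
          LetterLink (Letter L) M w x y ⊎ LetterLink (_≡ a) M w x y
        sort M (p , _ , inj₁ (here eq)) = inj₂ (p , eq)
        sort M (p , h , inj₁ (there l)) = inj₁ (p , h , inj₁ l)
        sort M (p , h , inj₂ i) = inj₁ (p , h , inj₂ i)
        block : ∀ M {w x y} → (∃ λ z → LetterLink (_≡ a) M w x z × Model.Word M (Letter L) w z y) →
          Block M (χ w) x y
        block M (z , (p , eq) , zs) with word-value M (Star.map (λ (q , h , _) → q , h) zs)
        ... | inj₁ refl = Model.comp₂ M p (recₗ M zs) , subst (_∈ T) (sym eq) a∈ , inj₁ eq
        ... | inj₂ (le , h) = Model.comp₂ M p (recₗ M zs) , subst (_∈ T) (sym eq') (closed a∈ h) , inj₂ (_ , h , eq')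
          where eq' = trans (Model.col-comp M (Model.D⇒≼ M p) le) (cong (_· _) eq)

  bounded-weaken : ∀ (L L' : S → Set) → (∀ {x} → L' x → L x) → Bounded L → Bounded L'
  bounded-weaken L L' f (ψ , rec) = ψ , λ M ws → rec M (Star.map (λ (p , h) → p , f h) ws)

  -- A letter a that is not left-cancellable on T lets words be cut into blocks with values in the smaller set a T;
  -- if all letters are left-cancellable, words are cut at repeated prefix values.
  factorization : ∀ n T → length T ≤ n → Closed T → Bounded (_∈ T)
  factorization zero [] _ _ = (λ w → w) , λ where
    M ε → Model.unit M
    M ((_ , ()) ◅ _)
  factorization (suc n) T len closed = bounded-weaken (Letter T closed T) (_∈ T) (λ h → h , inj₁ h) (letters T (λ h → h))
    where
    letters : ∀ L → (∀ {x} → x ∈ L → x ∈ T) → Bounded (Letter T closed L)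
    letters [] _ = bounded-weaken (Cancel T closed) (Letter T closed []) (λ where (h , inj₂ i) → h , i) (cancel-bounded T closed)
    letters (a ∷ L) L⊆T with inj-or-collision T a | letters L (λ h → L⊆T (there h))
    -- A left-cancellable `a` can leave the list, since `Letter` admits it by its second
    -- alternative.
    ... | inj₁ i | rec = bounded-weaken (Letter T closed L) (Letter T closed (a ∷ L))
          (λ where
            (h , inj₁ (here refl)) → h , inj₂ i
            (h , inj₁ (there l)) → h , inj₁ l
            (h , inj₂ j) → h , inj₂ j) rec
    ... | inj₂ col-a | rec = collision-bounded T closed a (L⊆T (here refl)) col-a
          (factorization n (image T closed a (L⊆T (here refl)) col-a)
            (s≤s⁻¹ (ℕ.≤-trans (image-length T closed a (L⊆T (here refl)) col-a) len))
            (image-closed T closed a (L⊆T (here refl)) col-a)) rec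

-- Boolean matrices

module Matrices (N : ℕ) where

  vectors : ∀ {X : Set} → List X → ∀ n → List (Vec X n)
  vectors xs zero    = [] ∷ []
  vectors xs (suc n) = cartesianProductWith _∷_ xs (vectors xs n)

  ∈-vectors : ∀ {X : Set} {xs : List X} → (∀ x → x ∈ xs) → ∀ {n} (v : Vec X n) → v ∈ vectors xs n
  ∈-vectors all []      = here refl
  ∈-vectors all (x ∷ v) = ∈-cartesianProductWith⁺ _∷_ (all x) (∈-vectors all v)

  -- Vectors instead of functions make equality extensional and decidable.
  Mat : Set
  Mat = Vec (Vec Bool N) N

  _≟ᴹ_ : DecidableEquality Mat
  _≟ᴹ_ = ≡-dec (≡-dec Bool._≟_)

  matrices : List Mat
  matrices = vectors (vectors (true ∷ false ∷ []) N) N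

  ∈-matrices : ∀ M → M ∈ matrices
  ∈-matrices = ∈-vectors (∈-vectors λ where
    true → here refl
    false → there (here refl))

  Entry : Mat → Fin N → Fin N → Set
  Entry M u v = lookup (lookup M u) v ≡ true

  entry? : ∀ M u v → Dec (Entry M u v)
  entry? M u v = lookup (lookup M u) v Bool.≟ true

  fromDec : {E : Fin N → Fin N → Set} → (∀ u v → Dec (E u v)) → Mat
  fromDec E? = tabulate λ u → tabulate λ v → does (E? u v)

  does-true : ∀ {X : Set} (d : Dec X) → does d ≡ true → X
  does-true (yes x) _ = x

  module _ {E : Fin N → Fin N → Set} (E? : ∀ u v → Dec (E u v)) where

    lookup-fromDec : ∀ u v → lookup (lookup (fromDec E?) u) v ≡ does (E? u v)
    lookup-fromDec u v = trans (cong (λ row → lookup row v) (lookup∘tabulate _ u)) (lookup∘tabulate _ v)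

    fromDec⁺ : ∀ {u v} → E u v → Entry (fromDec E?) u v
    fromDec⁺ {u} {v} e = trans (lookup-fromDec u v) (dec-true (E? u v) e)

    fromDec⁻ : ∀ {u v} → Entry (fromDec E?) u v → E u v
    fromDec⁻ {u} {v} e = does-true (E? u v) (trans (sym (lookup-fromDec u v)) e)

  lookup-ext : ∀ {X : Set} {n} {v w : Vec X n} → (∀ i → lookup v i ≡ lookup w i) → v ≡ w
  lookup-ext {v = v} {w} h = trans (sym (tabulate∘lookup v)) (trans (tabulate-cong h) (tabulate∘lookup w))

  bool-ext : ∀ {x y} → (x ≡ true → y ≡ true) → (y ≡ true → x ≡ true) → x ≡ y
  bool-ext {true}  {y}     f g = sym (f refl)
  bool-ext {false} {true}  f g = g refl
  bool-ext {false} {false} f g = refl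

  mat-ext : ∀ {M M'} → (∀ {u v} → Entry M u v → Entry M' u v) → (∀ {u v} → Entry M' u v → Entry M u v) → M ≡ M'
  mat-ext f g = lookup-ext λ u → lookup-ext λ v → bool-ext (f {u} {v}) g

  product? : ∀ M M' u v → Dec (∃ λ w → Entry M u w × Entry M' w v)
  product? M M' u v = Fin.any? λ w → entry? M u w ×-dec entry? M' w v

  abstract

    _·_ : Mat → Mat → Mat
    M · M' = fromDec (product? M M')

    ·⁺ : ∀ {M M' u w v} → Entry M u w → Entry M' w v → Entry (M · M') u v
    ·⁺ {M} {M'} e e' = fromDec⁺ (product? M M') (_ , e , e')

    ·⁻ : ∀ {M M' u v} → Entry (M · M') u v → ∃ λ w → Entry M u w × Entry M' w v
    ·⁻ {M} {M'} = fromDec⁻ (product? M M')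

  ·-assoc : ∀ x y z → (x · y) · z ≡ x · (y · z)
  ·-assoc x y z = mat-ext
    (λ h → let _ , h₁ , c = ·⁻ {x · y} {z} h; _ , a , b = ·⁻ {x} {y} h₁ in ·⁺ {x} {y · z} a (·⁺ {y} {z} b c))
    (λ h → let _ , a , h₁ = ·⁻ {x} {y · z} h; _ , b , c = ·⁻ {y} {z} h₁ in ·⁺ {x · y} {z} (·⁺ {x} {y} a b) c)

  module _ {e : Mat} (e·e : e · e ≡ e) where

    entry-trans : ∀ {u v w} → Entry e u v → Entry e v w → Entry e u w
    entry-trans {u} {v} {w} p q = subst (λ M → Entry M u w) e·e (·⁺ {e} {e} p q)

    entry-interpolate : ∀ {u v} → Entry e u v → ∃ λ w → Entry e u w × Entry e w v
    entry-interpolate {u} {v} p = ·⁻ {e} {e} (subst (λ M → Entry M u v) (sym e·e) p)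

    -- Repeated interpolation towards `v` gives a walk of `N + 1` points, each related to all later
    -- ones; two of them coincide by the pigeonhole principle, and that point is reflexive.
    reflexive-interpolate : ∀ {u v} → Entry e u v → ∃ λ z → Entry e u z × Entry e z z × Entry e z v
    reflexive-interpolate {u} {v} p =
      let i , j , i<j , eq = Fin.pigeonhole (ℕ.n<1+n N) (λ (i : Fin (suc N)) → pt (toℕ i)) in
      pt (toℕ i) , from-u (toℕ i) , subst (Entry e (pt (toℕ i))) (sym eq) (ascending (toℕ i) (toℕ j) i<j) , to-v (toℕ i)
      where
      walk : ℕ → ∃ λ w → Entry e u w × Entry e w v
      walk zero = entry-interpolate p
      walk (suc n) =
        let _ , a , b = walk n; w , c , d = entry-interpolate b in w , entry-trans a c , d
      pt : ℕ → Fin N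
      pt n = proj₁ (walk n)
      from-u : ∀ n → Entry e u (pt n)
      from-u n = proj₁ (proj₂ (walk n))
      to-v : ∀ n → Entry e (pt n) v
      to-v n = proj₂ (proj₂ (walk n))
      next : ∀ n → Entry e (pt n) (pt (suc n))
      next n = proj₁ (proj₂ (entry-interpolate (to-v n)))
      ascending : ∀ i j → i ℕ.< j → Entry e (pt i) (pt j)
      ascending i (suc j) i<j with ℕ.m<1+n⇒m<n∨m≡n i<j
      ... | inj₁ lt = entry-trans (ascending i j lt) (next j)
      ... | inj₂ refl = next j

-- Reachability along a path instance

module Paths (𝔸 : Structure) (P : PathInstance 𝔸) where

  open Structure 𝔸
  open PathInstance P

  A : Set
  A = Fin size

  resize : ∀ {X : Set} {k l} → l ≡ k → Vec X k → Vec X l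
  resize eq = subst (Vec _) (sym eq)

  toList-resize : ∀ {X : Set} {k l} (eq : l ≡ k) (xs : Vec X k) → toList (resize eq xs) ≡ toList xs
  toList-resize refl _ = refl

  map-resize : ∀ {X Y : Set} {k l} (f : X → Y) (eq : l ≡ k) (xs : Vec X k) →
    map f (resize eq xs) ≡ resize eq (map f xs)
  map-resize f refl _ = refl

  -- `Con` fixes a tuple only through its list of entries, because the length is an arity known to
  -- be 1 or 2 only by a proof.
  resize-unique : ∀ {X : Set} {k l} (eq : l ≡ k) (t : Vec X l) (xs : Vec X k) →
    toList t ≡ toList xs → t ≡ resize eq xs
  resize-unique refl t xs h = trans (sym (cast-is-id refl t)) (toList-injective refl t xs h)

  unary-arg : (i : Var 𝔸 P) → Vec (Var 𝔸 P) (arity (unary i))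
  unary-arg i = resize (unary-ar i) (i ∷ [])

  binary-arg : (k : Fin m) → Vec (Var 𝔸 P) (arity (binary k))
  binary-arg k = resize (binary-ar k) (inject₁ k ∷ fsuc k ∷ [])

  unary-con : ∀ i → Con 𝔸 P (unary i) (unary-arg i)
  unary-con i = uCon i (unary-arg i) (toList-resize (unary-ar i) (i ∷ []))

  binary-con : ∀ k → Con 𝔸 P (binary k) (binary-arg k)
  binary-con k = bCon k (binary-arg k) (toList-resize (binary-ar k) (inject₁ k ∷ fsuc k ∷ []))

  Ok : Var 𝔸 P → A → Set
  Ok i a = B 𝔸 P i a ≡ true

  Edge : Fin m → A → A → Set
  Edge k a b = rel (binary k) (resize (binary-ar k) (a ∷ b ∷ [])) ≡ true

  -- The relation E_ij, with the unary constraints at both ends included. It is generated at its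
  -- right end and is empty when `j` precedes `i`.
  data Reach (i : Var 𝔸 P) : Var 𝔸 P → A → A → Set where
    here : ∀ {a} → Ok i a → Reach i i a a
    snoc : ∀ {k a b c} → Reach i (inject₁ k) a b → Edge k b c → Ok (fsuc k) c → Reach i (fsuc k) a c

  abstract

    reach? : ∀ i j a b → Dec (Reach i j a b)
    reach? i = <-weakInduction (λ j → ∀ a b → Dec (Reach i j a b)) base next
      where
      Here : Var 𝔸 P → A → A → Set
      Here j a b = i ≡ j × a ≡ b × Ok i a
      here? : ∀ j a b → Dec (Here j a b)
      here? j a b = i Fin.≟ j ×-dec a Fin.≟ b ×-dec B 𝔸 P i a Bool.≟ true
      here⁺ : ∀ {j a b} → Here j a b → Reach i j a b
      here⁺ (refl , refl , ok) = here ok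
      base : ∀ a b → Dec (Reach i fzero a b)
      base a b = map′ here⁺ (λ where (here ok) → refl , refl , ok) (here? fzero a b)
      next : ∀ k → (∀ a b → Dec (Reach i (inject₁ k) a b)) → ∀ a c → Dec (Reach i (fsuc k) a c)
      next k rec a c = map′
        [ here⁺ , (λ (b , r , e , ok) → snoc r e ok) ]′
        (λ where
          (here ok) → inj₁ (refl , refl , ok)
          (snoc r e ok) → inj₂ (_ , r , e , ok))
        (here? (fsuc k) a c ⊎-dec
         Fin.any? (λ b → rec a b ×-dec rel (binary k) _ Bool.≟ true ×-dec B 𝔸 P (fsuc k) c Bool.≟ true))

  reach-okˡ : ∀ {i j a b} → Reach i j a b → Ok i a
  reach-okˡ (here ok) = ok
  reach-okˡ (snoc r _ _) = reach-okˡ r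

  reach-okʳ : ∀ {i j a b} → Reach i j a b → Ok j b
  reach-okʳ (here ok) = ok
  reach-okʳ (snoc _ _ ok) = ok

  ≤-inject₁ : ∀ {n} {i : Fin (suc n)} {k : Fin n} → i Fin.≤ inject₁ k → toℕ i ≤ toℕ k
  ≤-inject₁ {k = k} h = ℕ.≤-trans h (ℕ.≤-reflexive (Fin.toℕ-inject₁ k))

  reach-≤ : ∀ {i j a b} → Reach i j a b → i Fin.≤ j
  reach-≤ (here _) = Fin.≤-refl
  reach-≤ (snoc r _ _) = ℕ.m≤n⇒m≤1+n (≤-inject₁ (reach-≤ r))

  no-step-back : ∀ {k a b} → ¬ Reach (fsuc k) (inject₁ k) a b
  no-step-back r = ℕ.1+n≰n (≤-inject₁ (reach-≤ r))

  reach-trans : ∀ {i j k a b c} → Reach i j a b → Reach j k b c → Reach i k a c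
  reach-trans r (here _) = r
  reach-trans r (snoc s e ok) = snoc (reach-trans r s) e ok

  ≤-fsuc : ∀ {n} {j : Fin (suc n)} {k : Fin n} → j Fin.≤ fsuc k → j ≡ fsuc k ⊎ j Fin.≤ inject₁ k
  ≤-fsuc {j = j} {k} h with ℕ.m≤n⇒m<n∨m≡n h
  ... | inj₁ lt = inj₂ (ℕ.≤-trans (s≤s⁻¹ lt) (ℕ.≤-reflexive (sym (Fin.toℕ-inject₁ k))))
  ... | inj₂ eq = inj₁ (Fin.toℕ-injective eq)

  reach-split : ∀ {i j k a c} → i Fin.≤ j → j Fin.≤ k → Reach i k a c → ∃ λ b → Reach i j a b × Reach j k b c
  reach-split {i} {j} i≤j j≤i (here ok) with Fin.toℕ-injective (ℕ.≤-antisym i≤j j≤i)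
  ... | refl = _ , here ok , here ok
  reach-split i≤j j≤k r@(snoc s e ok) with ≤-fsuc j≤k
  ... | inj₁ refl = _ , r , here ok
  ... | inj₂ j≤k' = let b , u , v = reach-split i≤j j≤k' s in b , u , snoc v e ok

  -- For a variable `k` the arity equation can be matched with `refl`, which fails at the literal
  -- arities 1 and 2.
  polymorphism-resize : ∀ {p} → IsPolymorphism 𝔸 p → ∀ j {k} (eq : arity j ≡ k) (x y z : Vec A k) →
    rel j (resize eq x) ≡ true → rel j (resize eq y) ≡ true → rel j (resize eq z) ≡ true →
    rel j (resize eq (tabulate (λ c → p (lookup x c) (lookup y c) (lookup z c)))) ≡ true
  polymorphism-resize poly j refl = poly j

  module _ {p} (poly : IsPolymorphism 𝔸 p) where

    ok-poly : ∀ {i a b c} → Ok i a → Ok i b → Ok i c → Ok i (p a b c)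
    ok-poly {i} = polymorphism-resize poly (unary i) (unary-ar i) (_ ∷ []) (_ ∷ []) (_ ∷ [])

    edge-poly : ∀ {k a b c a' b' c'} → Edge k a a' → Edge k b b' → Edge k c c' → Edge k (p a b c) (p a' b' c')
    edge-poly {k} = polymorphism-resize poly (binary k) (binary-ar k) (_ ∷ _ ∷ []) (_ ∷ _ ∷ []) (_ ∷ _ ∷ [])

    reach-poly : ∀ {i j a b c a' b' c'} → Reach i j a a' → Reach i j b b' → Reach i j c c' →
      Reach i j (p a b c) (p a' b' c')
    reach-poly (snoc r e o) (snoc r' e' o') (snoc r'' e'' o'') =
      snoc (reach-poly r r' r'') (edge-poly e e' e'') (ok-poly o o' o'')
    reach-poly (here o) (here o') (here o'') = here (ok-poly o o' o'')
    -- The remaining cases mix a trivial path with a longer one between the same two variables.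
    reach-poly (here _) (snoc r _ _) _ = contradiction r no-step-back
    reach-poly (here _) (here _) (snoc r _ _) = contradiction r no-step-back
    reach-poly (snoc r _ _) (here _) _ = contradiction r no-step-back
    reach-poly (snoc r _ _) (snoc _ _ _) (here _) = contradiction r no-step-back

  -- Only the variables up to `j` are constrained; those beyond carry the last value as a default,
  -- overwritten at each extension.
  reach⇒partial : ∀ {j a b} → Reach fzero j a b → Σ (Var 𝔸 P → A) λ s →
    (∀ v → v Fin.≤ j → Ok v (s v)) ×
    (∀ k → fsuc k Fin.≤ j → Edge k (s (inject₁ k)) (s (fsuc k))) × s j ≡ b
  reach⇒partial {b = b} (here ok) = (λ _ → b) , oks , (λ k ()) , refl
    where
    oks : ∀ v → v Fin.≤ fzero {m} → Ok v b
    oks v v≤ with Fin.toℕ-injective {i = v} {j = fzero} (ℕ.n≤0⇒n≡0 v≤)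
    ... | refl = ok
  reach⇒partial {b = c} (snoc {k} r e ok) = extend , oks , edges , extend-new _ Fin.≤-refl
    where
    rec = reach⇒partial r
    s = proj₁ rec
    extend : Var 𝔸 P → A
    extend v with v Fin.≤? inject₁ k
    ... | yes _ = s v
    ... | no _  = c
    extend-old : ∀ v → v Fin.≤ inject₁ k → extend v ≡ s v
    extend-old v le with v Fin.≤? inject₁ k
    ... | yes _ = refl
    ... | no ¬le = contradiction le ¬le
    extend-new : ∀ v → fsuc k Fin.≤ v → extend v ≡ c
    extend-new v le with v Fin.≤? inject₁ k
    ... | yes le' = contradiction (ℕ.≤-trans le (≤-inject₁ {i = v} le')) ℕ.1+n≰n
    ... | no _ = refl
    oks : ∀ v → v Fin.≤ fsuc k → Ok v (extend v)
    oks v le with ≤-fsuc {j = v} {k} le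
    ... | inj₁ refl = subst (Ok v) (sym (extend-new v Fin.≤-refl)) ok
    ... | inj₂ le' = subst (Ok v) (sym (extend-old v le')) (proj₁ (proj₂ rec) v le')
    edges : ∀ l → fsuc l Fin.≤ fsuc k → Edge l (extend (inject₁ l)) (extend (fsuc l))
    edges l le with ≤-fsuc {j = fsuc l} {k} le
    ... | inj₁ refl rewrite extend-old (inject₁ l) Fin.≤-refl | extend-new (fsuc l) Fin.≤-refl | proj₂ (proj₂ (proj₂ rec)) = e
    ... | inj₂ le' rewrite extend-old (fsuc l) le'
                         | extend-old (inject₁ l) (ℕ.≤-trans (ℕ.≤-reflexive (Fin.toℕ-inject₁ l)) (ℕ.≤-trans (ℕ.n≤1+n _) le'))
      = proj₁ (proj₂ (proj₂ rec)) l le'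

  reach⇒satisfiable : ∀ {a b} → Reach fzero (fromℕ m) a b → Satisfiable 𝔸 P
  reach⇒satisfiable r = s , λ where
      _ t (uCon i _ eq) → subst (λ v → rel (unary i) v ≡ true)
        (sym (trans (cong (map s) (resize-unique (unary-ar i) t (i ∷ []) eq)) (map-resize s (unary-ar i) (i ∷ []))))
        (oks i (Fin.≤fromℕ i))
      _ t (bCon k _ eq) → subst (λ v → rel (binary k) v ≡ true)
        (sym (trans (cong (map s) (resize-unique (binary-ar k) t (inject₁ k ∷ fsuc k ∷ []) eq)) (map-resize s (binary-ar k) (inject₁ k ∷ fsuc k ∷ []))))
        (edges k (Fin.≤fromℕ (fsuc k)))
    where
    sol = reach⇒partial r
    s = proj₁ sol
    oks = proj₁ (proj₂ sol)
    edges = proj₁ (proj₂ (proj₂ sol))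

-- Symmetric derivations

module Derivations (𝔸 : Structure) (P : PathInstance 𝔸) (r' : ℕ) where

  open DecMembership (Fin._≟_ {suc (PathInstance.m P)}) using (_∈?_)
  open Structure 𝔸
  -- A successor guarantees a program variable that can serve as default.
  open Program 𝔸 (suc r')

  record State : Set where
    constructor state
    field
      {ar} : ℕ
      rl   : Rel size ar
      vars : Vec (Var 𝔸 P) ar

  open State

  ⟦_⟧ : State → (Var 𝔸 P → Fin size) → Set
  ⟦ s ⟧ g = rl s (map g (vars s)) ≡ true

  _∧ᴿ_ : ∀ {k a b} → Rel k a → Rel k b → Rel k (a + b)
  _∧ᴿ_ {a = zero}  R S v       = R [] ∧ S v
  _∧ᴿ_ {a = suc a} R S (x ∷ v) = ((λ w → R (x ∷ w)) ∧ᴿ S) v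

  ∧ᴿ-++ : ∀ {k a b} (R : Rel k a) (S : Rel k b) v w → (R ∧ᴿ S) (v ++ w) ≡ R v ∧ S w
  ∧ᴿ-++ R S []      w = refl
  ∧ᴿ-++ R S (x ∷ v) w = ∧ᴿ-++ (λ u → R (x ∷ u)) S v w

  _⊓_ : State → State → State
  s ⊓ t = state (rl s ∧ᴿ rl t) (vars s ++ vars t)

  infixl 6 _⊓_

  ⊓-eval : ∀ s t g → rl (s ⊓ t) (map g (vars (s ⊓ t))) ≡ rl s (map g (vars s)) ∧ rl t (map g (vars t))
  ⊓-eval s t g = trans (cong (rl (s ⊓ t)) (map-++ g (vars s) (vars t))) (∧ᴿ-++ (rl s) (rl t) _ _)

  ∧-true⁻ : ∀ {x y} → x ∧ y ≡ true → x ≡ true × y ≡ true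
  ∧-true⁻ {true} {true} _ = refl , refl

  ⊓⁻ : ∀ s t {g} → ⟦ s ⊓ t ⟧ g → ⟦ s ⟧ g × ⟦ t ⟧ g
  ⊓⁻ s t {g} h = ∧-true⁻ (trans (sym (⊓-eval s t g)) h)

  ⊓⁺ : ∀ s t {g} → ⟦ s ⟧ g → ⟦ t ⟧ g → ⟦ s ⊓ t ⟧ g
  ⊓⁺ s t {g} h h' = trans (⊓-eval s t g) (cong₂ _∧_ h h')

  Der : State → Set
  Der s = Derives P (ar s) (rl s) (vars s)

  record Constraint : Set where
    field
      sym# : Fin nrel
      arg  : Vec (Var 𝔸 P) (arity sym#)
      con  : Con 𝔸 P sym# arg
      ar≤  : arity sym# ≤ suc r'

  open Constraint

  Holds : (Var 𝔸 P → Fin size) → Constraint → Set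
  Holds g c = rel (sym# c) (map g (arg c)) ≡ true

  module Renaming {k} (W : Vec (Var 𝔸 P) k) (k≤r : k ≤ suc r') where

    -- Junk values: idx is 0 off W, and ω is 0 beyond the length of W.
    idx : Var 𝔸 P → Fin (suc r')
    idx v with v ∈? W
    ... | yes p = inject≤ (index p) k≤r
    ... | no _  = fzero

    ω : Fin (suc r') → Var 𝔸 P
    ω x with toℕ x <? k
    ... | yes p = lookup W (fromℕ< p)
    ... | no _  = fzero

    ω-inject : ∀ i → ω (inject≤ i k≤r) ≡ lookup W i
    ω-inject i with toℕ (inject≤ i k≤r) <? k
    ... | yes p = cong (lookup W) (go _ p (Fin.toℕ-inject≤ i k≤r))
      where
      go : ∀ n (p : n ℕ.< k) → n ≡ toℕ i → fromℕ< p ≡ i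
      go _ p refl = Fin.fromℕ<-toℕ i p
    ... | no ¬p = ⊥-elim (¬p (subst (ℕ._< k) (sym (Fin.toℕ-inject≤ i k≤r)) (Fin.toℕ<n i)))

    ω∘idx : ∀ {v} → v ∈ᵛ W → ω (idx v) ≡ v
    ω∘idx {v} v∈ with v ∈? W
    ... | yes p = trans (ω-inject (index p)) (sym (lookup-index p))
    ... | no ¬p = ⊥-elim (¬p v∈)

    map-ω∘idx : ∀ {n} {xs : Vec _ n} → VAll.All (_∈ᵛ W) xs → map ω (map idx xs) ≡ xs
    map-ω∘idx [] = refl
    map-ω∘idx (p ∷ ps) = cong₂ _∷_ (ω∘idx p) (map-ω∘idx ps)

    iatomOf : (s : State) → ar s ≤ suc r' → IAtom
    iatomOf s le = iatom (ar s) le (rl s) (map idx (vars s))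

    eatomOf : Constraint → EAtom
    eatomOf c = eatom (sym# c) (ar≤ c) (map idx (arg c))

    -- Consistency of a rule speaks of assignments `f` of program variables. As `f ∘ idx` assigns
    -- instance variables, it follows from implications between states.
    holdsI : ∀ s le f → HoldsI f (iatomOf s le) ≡ ⟦ s ⟧ (f ∘ idx)
    holdsI s le f = cong (λ v → rl s v ≡ true) (sym (map-∘ f idx (vars s)))

    holdsE : ∀ c f → HoldsE f (eatomOf c) ≡ Holds (f ∘ idx) c
    holdsE c f = cong (λ v → rel (sym# c) v ≡ true) (sym (map-∘ f idx (arg c)))

    holdsAll : ∀ {cs f} → All (HoldsE f) (List.map eatomOf cs) → All (Holds (f ∘ idx)) cs
    holdsAll {f = f} = All.map (λ {c} → subst id (holdsE c f)) ∘ All.map⁻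

    consAll : ∀ {cs} → All (λ c → VAll.All (_∈ᵛ W) (arg c)) cs →
      All (λ e → Con 𝔸 P (EAtom.symb e) (map ω (EAtom.args e))) (List.map eatomOf cs)
    consAll = All.map⁺ ∘ All.map (λ {c} h → subst (Con 𝔸 P (sym# c)) (sym (map-ω∘idx h)) (con c))

  module _ {k} (W : Vec (Var 𝔸 P) k) (k≤r : k ≤ suc r') (cs : List Constraint)
    (distinct : AllPairs _≢_ (List.map (Renaming.eatomOf W k≤r) cs))
    (cs⊆ : All (λ c → VAll.All (_∈ᵛ W) (arg c)) cs) where

    open Renaming W k≤r

    start-step : ∀ t → ar t ≤ suc r' → VAll.All (_∈ᵛ W) (vars t) →
      (∀ g → All (Holds g) cs → ⟦ t ⟧ g) → Der t
    start-step t t≤ t⊆ imp = subst (Derives P _ _) (map-ω∘idx t⊆) (byRule rule ω (consAll cs⊆) MaybeAll.nothing)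
      where
      rule : Rule
      rule = record
        { head = iatomOf t t≤
        ; edbs = List.map eatomOf cs
        ; idb = nothing
        ; distinct = distinct
        ; consistent = λ f hs _ → subst id (sym (holdsI t t≤ f)) (imp _ (holdsAll hs))
        ; symmetric = λ _ ()
        }

    -- Equivalence modulo `cs` is exactly what conditions (4) and (5) ask of the rule with body `s`,
    -- `cs` and head `t`; listing all variables in `W` makes `r` program variables enough.
    step : ∀ s t → ar s ≤ suc r' → ar t ≤ suc r' → VAll.All (_∈ᵛ W) (vars s) → VAll.All (_∈ᵛ W) (vars t) →
      (∀ g → All (Holds g) cs → ⟦ s ⟧ g → ⟦ t ⟧ g) →
      (∀ g → All (Holds g) cs → ⟦ t ⟧ g → ⟦ s ⟧ g) → Der s → Der t
    step s t s≤ t≤ s⊆ t⊆ imp imp⁻ D = subst (Derives P _ _) (map-ω∘idx t⊆)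
        (byRule rule ω (consAll cs⊆) (MaybeAll.just (subst (Derives P _ _) (sym (map-ω∘idx s⊆)) D)))
      where
      rule : Rule
      rule = record
        { head = iatomOf t t≤
        ; edbs = List.map eatomOf cs
        ; idb = just (iatomOf s s≤)
        ; distinct = distinct
        ; consistent = λ where
            f hs (MaybeAll.just h) → subst id (sym (holdsI t t≤ f)) (imp _ (holdsAll hs) (subst id (holdsI s s≤ f) h))
        ; symmetric = λ where
            _ refl f hs h → subst id (sym (holdsI s s≤ f)) (imp⁻ _ (holdsAll hs) (subst id (holdsI t t≤ f) h))
        }

  -- Attaching and detaching derivable facts

  Conn : State → State → Set
  Conn s t = (Der s → Der t) × (Der t → Der s)

  infixr 5 _⨾_
  _⨾_ : ∀ {s t u} → Conn s t → Conn t u → Conn s u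
  (f , f⁻) ⨾ (g , g⁻) = g ∘ f , f⁻ ∘ g⁻

  equiv : ∀ {k} (W : Vec (Var 𝔸 P) k) → k ≤ suc r' → ∀ s t →
    ar s ≤ suc r' → ar t ≤ suc r' → VAll.All (_∈ᵛ W) (vars s) → VAll.All (_∈ᵛ W) (vars t) →
    (∀ g → ⟦ s ⟧ g → ⟦ t ⟧ g) → (∀ g → ⟦ t ⟧ g → ⟦ s ⟧ g) → Conn s t
  equiv W k≤r s t s≤ t≤ s⊆ t⊆ imp imp⁻ =
    step W k≤r [] [] [] s t s≤ t≤ s⊆ t⊆ (λ g _ → imp g) (λ g _ → imp⁻ g) ,
    step W k≤r [] [] [] t s t≤ s≤ t⊆ s⊆ (λ g _ → imp⁻ g) (λ g _ → imp g)

  ⊆-refl : ∀ {n} (xs : Vec (Var 𝔸 P) n) → VAll.All (_∈ᵛ xs) xs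
  ⊆-refl xs = go xs id
    where
    go : ∀ {n k} {ys : Vec (Var 𝔸 P) k} (xs : Vec _ n) → (∀ {v} → v ∈ᵛ xs → v ∈ᵛ ys) → VAll.All (_∈ᵛ ys) xs
    go [] f = []
    go (x ∷ xs) f = f (here refl) ∷ go xs (f ∘ there)

  ⊆-left : ∀ {n m k} {xs : Vec (Var 𝔸 P) n} {ys : Vec _ m} {zs : Vec _ k} →
    VAll.All (_∈ᵛ ys) xs → VAll.All (_∈ᵛ ys ++ zs) xs
  ⊆-left = VAll.map ∈-++⁺ˡ

  ⊆-right : ∀ {n m k} {xs : Vec (Var 𝔸 P) n} (ys : Vec _ m) {zs : Vec _ k} →
    VAll.All (_∈ᵛ zs) xs → VAll.All (_∈ᵛ ys ++ zs) xs
  ⊆-right ys = VAll.map (∈-++⁺ʳ ys)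

  -- Φ is a lemma that can be attached to and detached from any state leaving room for w more variables.
  Avail : ℕ → State → Set
  Avail w Φ = ∀ s → ar s + w ≤ suc r' → Conn s (s ⊓ Φ)

  avail-mono : ∀ {v w Φ} → v ≤ w → Avail v Φ → Avail w Φ
  avail-mono le h s fit = h s (ℕ.≤-trans (ℕ.+-monoʳ-≤ (ar s) le) fit)

  attach : ∀ {w Φ} s Ψ → Avail w Φ → ar s + (ar Ψ + w) ≤ suc r' → Conn (s ⊓ Ψ) (s ⊓ Ψ ⊓ Φ)
  attach s Ψ h fit = h (s ⊓ Ψ) (ℕ.≤-trans (ℕ.≤-reflexive (ℕ.+-assoc (ar s) (ar Ψ) _)) fit)

  -- The three bounds on `u` pay for attaching `Φ`, for attaching `Ψ` while `Φ` stays, and for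
  -- holding both.
  avail-⊓ : ∀ {v w u Φ Ψ} → Avail v Φ → Avail w Ψ →
    v ≤ u → ar Φ + w ≤ u → ar Φ + ar Ψ ≤ u → Avail u (Φ ⊓ Ψ)
  avail-⊓ {Φ = Φ} {Ψ} h h' le₁ le₂ le₃ s fit =
    avail-mono le₁ h s fit ⨾
    attach s Φ h' (bound le₂) ⨾
    equiv W W≤ (s ⊓ Φ ⊓ Ψ) (s ⊓ (Φ ⊓ Ψ))
      (ℕ.≤-trans (ℕ.≤-reflexive (ℕ.+-assoc (ar s) (ar Φ) (ar Ψ))) W≤) W≤
      (VAll.++⁺ (VAll.++⁺ s⊆ Φ⊆) Ψ⊆) (⊆-refl W)
      (λ g x → let sφ , ψ = ⊓⁻ (s ⊓ Φ) Ψ x; a , φ = ⊓⁻ s Φ sφ in ⊓⁺ s (Φ ⊓ Ψ) a (⊓⁺ Φ Ψ φ ψ))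
      (λ g x → let a , φψ = ⊓⁻ s (Φ ⊓ Ψ) x; φ , ψ = ⊓⁻ Φ Ψ φψ in ⊓⁺ (s ⊓ Φ) Ψ (⊓⁺ s Φ a φ) ψ)
    where
    W = vars (s ⊓ (Φ ⊓ Ψ))
    bound : ∀ {x} → x ≤ _ → ar s + x ≤ suc r'
    bound le = ℕ.≤-trans (ℕ.+-monoʳ-≤ (ar s) le) fit
    W≤ = bound le₃
    s⊆ = ⊆-left (⊆-refl (vars s))
    Φ⊆ = ⊆-right (vars s) (⊆-left (⊆-refl (vars Φ)))
    Ψ⊆ = ⊆-right (vars s) (⊆-right (vars Φ) (⊆-refl (vars Ψ)))

  -- `Φ` is attached, then `F`; under `F` the state `Φ` is exchanged for `Ψ`, and `F` is detached.
  -- The cost `v` of `Φ` enters only through a maximum, so repeated exchanges need not accumulate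
  -- cost.
  avail-equiv : ∀ {v w u Φ Ψ F} → Avail v Φ → Avail w F →
    v ≤ u → ar Φ + w ≤ u → ar Ψ + w ≤ u → ar Φ + (ar Ψ + ar F) ≤ u →
    (∀ g → ⟦ F ⟧ g → ⟦ Φ ⟧ g → ⟦ Ψ ⟧ g) → (∀ g → ⟦ F ⟧ g → ⟦ Ψ ⟧ g → ⟦ Φ ⟧ g) → Avail u Ψ
  avail-equiv {Φ = Φ} {Ψ} {F} h f le₁ le₂ le₃ le₄ imp imp⁻ s fit =
    avail-mono le₁ h s fit ⨾
    attach s Φ f (bound le₂) ⨾
    equiv W W≤ (s ⊓ Φ ⊓ F) (s ⊓ Ψ ⊓ F)
      (ℕ.≤-trans (ℕ.≤-reflexive (ℕ.+-assoc (ar s) (ar Φ) (ar F))) (bound (ℕ.≤-trans (ℕ.+-monoʳ-≤ (ar Φ) (ℕ.m≤n+m (ar F) (ar Ψ))) le₄)))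
      (ℕ.≤-trans (ℕ.≤-reflexive (ℕ.+-assoc (ar s) (ar Ψ) (ar F))) (bound (ℕ.≤-trans (ℕ.m≤n+m _ (ar Φ)) le₄)))
      (VAll.++⁺ (VAll.++⁺ s⊆ Φ⊆) F⊆) (VAll.++⁺ (VAll.++⁺ s⊆ Ψ⊆) F⊆)
      (λ g x → let aφ , y = ⊓⁻ (s ⊓ Φ) F x; a , φ = ⊓⁻ s Φ aφ in ⊓⁺ (s ⊓ Ψ) F (⊓⁺ s Ψ a (imp g y φ)) y)
      (λ g x → let aψ , y = ⊓⁻ (s ⊓ Ψ) F x; a , ψ = ⊓⁻ s Ψ aψ in ⊓⁺ (s ⊓ Φ) F (⊓⁺ s Φ a (imp⁻ g y ψ)) y) ⨾
    swap (attach s Ψ f (bound le₃))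
    where
    W = vars (s ⊓ (Φ ⊓ (Ψ ⊓ F)))
    bound : ∀ {x} → x ≤ _ → ar s + x ≤ suc r'
    bound le = ℕ.≤-trans (ℕ.+-monoʳ-≤ (ar s) le) fit
    W≤ = bound le₄
    s⊆ = ⊆-left (⊆-refl (vars s))
    Φ⊆ = ⊆-right (vars s) (⊆-left (⊆-refl (vars Φ)))
    Ψ⊆ = ⊆-right (vars s) (⊆-right (vars Φ) (⊆-left (⊆-refl (vars Ψ))))
    F⊆ = ⊆-right (vars s) (⊆-right (vars Φ) (⊆-right (vars Ψ) (⊆-refl (vars F))))

  ⊤ˢ : State
  ⊤ˢ = state (λ _ → true) []

  ⊤ˢ-der : Der ⊤ˢ
  ⊤ˢ-der = start-step [] z≤n [] [] [] ⊤ˢ z≤n [] (λ _ _ → refl)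

  avail-⊤ : Avail 0 ⊤ˢ
  avail-⊤ s fit = equiv (vars (s ⊓ ⊤ˢ)) fit s (s ⊓ ⊤ˢ)
    (ℕ.≤-trans (ℕ.m≤m+n _ 0) fit) fit (⊆-left (⊆-refl (vars s))) (⊆-refl (vars (s ⊓ ⊤ˢ)))
    (λ g x → ⊓⁺ s ⊤ˢ x refl) (λ g x → proj₁ (⊓⁻ s ⊤ˢ x))

  -- Modulo `F` the state `Ψ` is equivalent to the trivial one, so it can be exchanged for `⊤ˢ`.
  avail-imp : ∀ {w u Ψ F} → Avail w F → ar Ψ + w ≤ u → ar Ψ + ar F ≤ u →
    (∀ g → ⟦ F ⟧ g → ⟦ Ψ ⟧ g) → Avail u Ψ
  avail-imp {Ψ = Ψ} f le₁ le₂ imp =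
    avail-equiv avail-⊤ f z≤n (ℕ.≤-trans (ℕ.m≤n+m _ (ar Ψ)) le₁) le₁ le₂ (λ g x _ → imp g x) (λ _ _ _ → refl)

  constraint-state : ∀ {j} {t : Vec (Var 𝔸 P) (arity j)} → Con 𝔸 P j t → State
  constraint-state {j} {t} _ = state (rel j) t

  -- With the constraint as an EDB atom of the rule, both directions are consistent.
  avail-constraint : ∀ {j t} (c : Con 𝔸 P j t) → Avail (arity j) (constraint-state c)
  avail-constraint {j} {t} c s fit =
    step W fit cs ([] ∷ []) cs⊆ s (s ⊓ Φ) s≤ fit s⊆ W⊆ (λ g hs x → ⊓⁺ s Φ x (All.head hs)) (λ g _ x → proj₁ (⊓⁻ s Φ x)) ,
    step W fit cs ([] ∷ []) cs⊆ (s ⊓ Φ) s fit s≤ W⊆ s⊆ (λ g _ x → proj₁ (⊓⁻ s Φ x)) (λ g hs x → ⊓⁺ s Φ x (All.head hs))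
    where
    Φ = constraint-state c
    W = vars (s ⊓ Φ)
    cs = record { sym# = j; arg = t; con = c; ar≤ = ℕ.≤-trans (ℕ.m≤n+m _ (ar s)) fit } ∷ []
    s≤ = ℕ.≤-trans (ℕ.m≤m+n (ar s) _) fit
    s⊆ = ⊆-left {zs = t} (⊆-refl (vars s))
    W⊆ = ⊆-refl W
    cs⊆ = ⊆-right (vars s) (⊆-refl t) ∷ []

  goal : ∀ {w Φ} → Avail w Φ → w ≤ suc r' → ar Φ ≤ suc r' → (∀ v → rl Φ v ≡ false) → DerivesGoal P
  -- `⊤ˢ ⊓ Φ` computes to `Φ`, so attaching `Φ` to the derivable state `⊤ˢ` derives `Φ` itself.
  goal {Φ = Φ} h w≤ ar≤ empty = ar Φ , ar≤ , rl Φ , empty , vars Φ , proj₁ (h ⊤ˢ w≤) ⊤ˢ-der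

-- Chains of segments with a common idempotent matrix

-- Only surjectivity onto the elements satisfying `p` matters. Surplus labels name `x₀`, which need
-- not satisfy `p`.
enumerate : ∀ {X : Set} (p : X → Bool) {k} (xs : Vec X k) {N} → countᵇ p xs ≤ N → X →
  Σ (Fin N → X) λ en → ∀ {x} → x ∈ᵛ xs → p x ≡ true → ∃ λ u → x ≡ en u
enumerate p [] le x₀ = (λ _ → x₀) , λ ()
enumerate p (x ∷ xs) le x₀ with p x in eq
enumerate p (x ∷ xs) {suc N} (s≤s le) x₀ | true =
  let en , sur = enumerate p xs le x₀ in
  (λ where fzero → x; (fsuc u) → en u) , λ where
    (here refl) _ → fzero , refl
    (there h) px → let u , eq = sur h px in fsuc u , eq
enumerate p (x ∷ xs) le x₀ | false =
  let en , sur = enumerate p xs le x₀ in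
  en , λ where
    (here refl) px → contradiction (trans (sym px) eq) λ ()
    (there h) px → sur h px

data Chain {P : Set} (R : P → P → Set) : ℕ → P → P → Set where
  []  : ∀ {i} → Chain R 0 i i
  _∷_ : ∀ {l i j k} → R i j → Chain R l j k → Chain R (suc l) i k

-- The term `n * 4` pays for composing up to `n` links one by one at 4 each; sliding along a longer
-- chain costs at most `10 + w`.
chain-cost : ℕ → ℕ → ℕ
chain-cost n w = 20 + w + n * 4

module Construction (n N : ℕ) (𝔸 : Structure) (perm : NPermutable 𝔸 n) (P : PathInstance 𝔸)
  (card≤ : ∀ i → card 𝔸 P i ≤ N) (a₀ : Fin (Structure.size 𝔸)) (r' : ℕ) where

  open Matrices N
  open Paths 𝔸 P
  open Derivations 𝔸 P r'
  open PathInstance P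

  label : ∀ i → Fin N → A
  label i = proj₁ (enumerate (B 𝔸 P i) (allFin _) (card≤ i) a₀)

  label-onto : ∀ {i a} → Ok i a → ∃ λ u → a ≡ label i u
  label-onto {i} {a} = proj₂ (enumerate (B 𝔸 P i) (allFin _) (card≤ i) a₀) (∈-allFin⁺ a)

  col? : ∀ i j u v → Dec (Reach i j (label i u) (label j v))
  col? i j u v = reach? i j (label i u) (label j v)

  abstract

    col : Var 𝔸 P → Var 𝔸 P → Mat
    col i j = fromDec (col? i j)

    col⁺ : ∀ {i j u v} → Reach i j (label i u) (label j v) → Entry (col i j) u v
    col⁺ {i} {j} = fromDec⁺ (col? i j)

    col⁻ : ∀ {i j u v} → Entry (col i j) u v → Reach i j (label i u) (label j v)
    col⁻ {i} {j} = fromDec⁻ (col? i j)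

  col-comp : ∀ {i j k} → i Fin.≤ j → j Fin.≤ k → col i k ≡ col i j · col j k
  col-comp {i} {j} {k} i≤j j≤k = mat-ext
    (λ h → let b , r , s = reach-split i≤j j≤k (col⁻ h); w , eq = label-onto (reach-okʳ r) in
           ·⁺ {col i j} {col j k} (col⁺ (subst (Reach i j _) eq r)) (col⁺ (subst (λ b → Reach j k b _) eq s)))
    (λ h → let _ , r , s = ·⁻ {col i j} {col j k} h in col⁺ (reach-trans (col⁻ r) (col⁻ s)))

  -- If u reaches itself, v reaches itself and v reaches u along every link, then the path
  -- p₀(u,u,v), p₁(u,u,v), …, pₙ(u,u,v) leads from u to v.
  hagemann-mitschke : ∀ {l} (p : Fin (suc l) → Ternary 𝔸) → (∀ t → IsPolymorphism 𝔸 (p t)) →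
    (∀ t x y → p (inject₁ t) x x y ≡ p (fsuc t) x y y) →
    ∀ {u v i j} → Ok i (label i u) → Ok i (label i v) →
    Chain (λ x y → x Fin.≤ y × Entry (col x y) u u × Entry (col x y) v v × Entry (col x y) v u) l i j →
    Reach i j (p fzero (label i u) (label i u) (label i v)) (p (fromℕ l) (label j u) (label j u) (label j v))
  hagemann-mitschke p poly eqs oku okv [] = here (ok-poly {p fzero} (poly fzero) oku oku okv)
  hagemann-mitschke p poly eqs {i = i} oku okv ((_ , uu , vv , vu) ∷ ch) =
    reach-trans
      -- The identity rewrites p₀(u,u,v) as p₁(u,v,v); then p₁ applied to the paths from u to u, v
      -- to u and v to v leads to p₁(u,u,v).
      (subst (λ a → Reach i _ a (p (fsuc fzero) _ _ _)) (sym (eqs fzero _ _))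
        (reach-poly {p (fsuc fzero)} (poly (fsuc fzero)) (col⁻ uu) (col⁻ vu) (col⁻ vv)))
      (hagemann-mitschke (p ∘ fsuc) (poly ∘ fsuc) (eqs ∘ fsuc) (reach-okʳ (col⁻ uu)) (reach-okʳ (col⁻ vv)) ch)

  module Idempotent {e : Mat} (e·e : e · e ≡ e) where

    Link : Var 𝔸 P → Var 𝔸 P → Set
    Link x y = x Fin.≤ y × col x y ≡ e

    link-chain : ∀ {l i j k} → Link i j → Chain Link l j k → Link i k
    link-chain h [] = h
    link-chain (i≤j , eq) ((j≤k , eq') ∷ ch) =
      link-chain (ℕ.≤-trans i≤j j≤k , trans (col-comp i≤j j≤k) (trans (cong₂ _·_ eq eq') e·e)) ch

    Symmetric : Set
    Symmetric = ∀ {u v} → Entry e u u → Entry e v v → Entry e v u → Entry e u v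

    -- The chain has one link per identity. The link in front of it makes `u` and `v` satisfy the
    -- unary constraint at `j`, and gives the whole segment the matrix `e` even for `n = 0`.
    chain-symmetric : ∀ {i j k} → Link i j → Chain Link n j k → Symmetric
    chain-symmetric {i} {j} {k} l@(_ , eq) ch {u} {v} uu vv vu =
      let p , poly , p₀ , eqs , pₙ = perm
          _ , eq' = link-chain l ch
          e→col : ∀ {u v} → Entry e u v → Entry (col i j) u v
          e→col {u} {v} = subst (λ M → Entry M u v) (sym eq)
          r = hagemann-mitschke p poly eqs (reach-okʳ (col⁻ (e→col uu))) (reach-okʳ (col⁻ (e→col vv))) (weaken ch)
          r' = subst (λ a → Reach j k a _) (p₀ _ _ _) (subst (Reach j k _) (pₙ _ _ _) r)
      in subst (λ M → Entry M u v) eq' (col⁺ (reach-trans (col⁻ (e→col uu)) r'))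
      where
      weaken : ∀ {l i j} → Chain Link l i j →
        Chain (λ x y → x Fin.≤ y × Entry (col x y) u u × Entry (col x y) v v × Entry (col x y) v u) l i j
      weaken [] = []
      weaken ((le , refl) ∷ ch) = (le , uu , vv , vu) ∷ weaken ch

    module _ (symmetric : Symmetric) where

      -- All reflexive elements on a walk lie in one class of the equivalence relation that e induces on them.
      entry-back : ∀ {o t x y z} → Entry e t x → Entry e x y → Entry e y z → Entry e o y → Entry e o x
      entry-back tx xy yz oy =
        let w , _ , ww , wx = reflexive-interpolate e·e tx
            q , yq , qq , _ = reflexive-interpolate e·e yz
            s , os , ss , sy = reflexive-interpolate e·e oy
            -- Symmetry reverses s to q, and then w to s, so that o reaches x through s and w.
            qs = symmetric qq ss (sy ∙ yq)
            sw = symmetric ss ww (wx ∙ xy ∙ yq ∙ qs)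
        in os ∙ sw ∙ wx
        where
        infixr 5 _∙_
        _∙_ : ∀ {u v w} → Entry e u v → Entry e v w → Entry e u w
        _∙_ = entry-trans e·e

      link-entry : ∀ {i j u v} → Link i j → Reach i j (label i u) (label j v) → Entry e u v
      link-entry {u = u} {v} (_ , eq) r = subst (λ M → Entry M u v) eq (col⁺ r)

      -- Values on a path satisfy their unary constraints and so carry labels; this transfers
      -- `entry-back` from labels to values.
      reach-back : ∀ {o t x y z a b c d f} → Link o x → Link o y → Link t x → Link x y → Link y z →
        Reach t x b c → Reach x y c d → Reach y z d f → Reach o y a d → Reach o x a c
      reach-back {o} {x = x} lox loy ltx lxy lyz rtx rxy ryz roy
        with label-onto (reach-okˡ rtx) | label-onto (reach-okˡ rxy) | label-onto (reach-okˡ ryz)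
           | label-onto (reach-okʳ ryz) | label-onto (reach-okˡ roy)
      ... | _ , refl | _ , refl | _ , refl | _ , refl | _ , refl =
        col⁻ (subst (λ M → Entry M _ _) (sym (proj₂ lox))
          (entry-back (link-entry ltx rtx) (link-entry lxy rxy) (link-entry lyz ryz) (link-entry loy roy)))

  -- Facts for subpaths and the cost of deriving them

  fact : Var 𝔸 P → Var 𝔸 P → State
  fact i j = state (λ where (a ∷ b ∷ []) → does (reach? i j a b)) (i ∷ j ∷ [])

  fact⁺ : ∀ i j g → Reach i j (g i) (g j) → ⟦ fact i j ⟧ g
  fact⁺ i j g = dec-true (reach? i j (g i) (g j))

  fact⁻ : ∀ i j g → ⟦ fact i j ⟧ g → Reach i j (g i) (g j)
  fact⁻ i j g = does-true (reach? i j (g i) (g j))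

  -- The offset pays for the unary facts behind the base cases D-unit and D-edge.
  D : ℕ → Var 𝔸 P → Var 𝔸 P → Set
  D w i j = i Fin.≤ j × Avail (10 + w) (fact i j)

  D-mono : ∀ {v w i j} → v ≤ w → D v i j → D w i j
  D-mono le (i≤j , h) = i≤j , avail-mono (ℕ.+-monoʳ-≤ 10 le) h

  lift : ∀ {k} l {w} → k ≤ l → k + w ≤ l + w
  lift l {w} = ℕ.+-monoˡ-≤ w

  small : ∀ {k} l {w} → k ≤ l → k ≤ l + w
  small l {w} le = ℕ.≤-trans le (ℕ.m≤m+n l w)

  -- Keeping the first fact, of width 2, while the second is attached costs 2 more; keeping the
  -- composite beside both costs another 2.
  D-comp : ∀ {w i j k} → D w i j → D w j k → D (4 + w) i k
  D-comp {w} {i} {j} {k} (i≤j , f) (j≤k , f') = ℕ.≤-trans i≤j j≤k ,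
    avail-imp {F = fact i j ⊓ fact j k}
      (avail-⊓ {u = 12 + w} f f' (lift 12 (ℕ.m≤m+n 10 2)) ℕ.≤-refl (small 12 (ℕ.m≤m+n 4 8)))
      ℕ.≤-refl (small 14 (ℕ.m≤m+n 6 8))
      λ g h → let r , s = ⊓⁻ (fact i j) (fact j k) h in fact⁺ i k g (reach-trans (fact⁻ i j g r) (fact⁻ j k g s))

  unaryˢ : Var 𝔸 P → State
  unaryˢ i = constraint-state (unary-con i)

  unaryˢ⁻ : ∀ i g → ⟦ unaryˢ i ⟧ g → Ok i (g i)
  unaryˢ⁻ i g = subst (λ v → Structure.rel 𝔸 (unary i) v ≡ true) (map-resize g (unary-ar i) (i ∷ []))

  binaryˢ : Fin m → State
  binaryˢ k = constraint-state (binary-con k)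

  binaryˢ⁻ : ∀ k g → ⟦ binaryˢ k ⟧ g → Edge k (g (inject₁ k)) (g (fsuc k))
  binaryˢ⁻ k g = subst (λ v → Structure.rel 𝔸 (binary k) v ≡ true) (map-resize g (binary-ar k) (inject₁ k ∷ fsuc k ∷ []))

  unary-avail : ∀ i → Avail 1 (unaryˢ i)
  unary-avail i = avail-mono (ℕ.≤-reflexive (unary-ar i)) (avail-constraint (unary-con i))

  binary-avail : ∀ k → Avail 2 (binaryˢ k)
  binary-avail k = avail-mono (ℕ.≤-reflexive (binary-ar k)) (avail-constraint (binary-con k))

  D-unit : ∀ {w i} → D w i i
  D-unit {w} {i} = ℕ.≤-refl , avail-imp (unary-avail i) (small 10 (ℕ.m≤m+n 3 7))
    (small 10 (ℕ.≤-trans (ℕ.≤-reflexive (cong (2 +_) (unary-ar i))) (ℕ.m≤m+n 3 7)))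
    λ g h → fact⁺ i i g (here (unaryˢ⁻ i g h))

  D-edge : ∀ k → D 10 (inject₁ k) (fsuc k)
  D-edge k = ℕ.≤-trans (ℕ.≤-reflexive (Fin.toℕ-inject₁ k)) (ℕ.n≤1+n _) ,
    avail-imp {F = unaryˢ i ⊓ (binaryˢ k ⊓ unaryˢ j)}
      (avail-⊓ {u = 10} (unary-avail i)
        (avail-⊓ {u = 5} (binary-avail k) (unary-avail j) (ℕ.m≤m+n 2 3)
          (subst (λ a → a + 1 ≤ 5) (sym (binary-ar k)) (ℕ.m≤m+n 3 2))
          (ℕ.≤-trans (ℕ.≤-reflexive (cong₂ _+_ (binary-ar k) (unary-ar j))) (ℕ.m≤m+n 3 2)))
        (ℕ.m≤m+n 1 9)
        (subst (λ a → a + 5 ≤ 10) (sym (unary-ar i)) (ℕ.m≤m+n 6 4))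
        (ℕ.≤-trans F≤ (ℕ.m≤m+n 4 6)))
      (ℕ.m≤m+n 12 8)
      (ℕ.≤-trans (ℕ.+-monoʳ-≤ 2 F≤) (ℕ.m≤m+n 6 14))
      λ g h → let u , h' = ⊓⁻ (unaryˢ i) (binaryˢ k ⊓ unaryˢ j) h; b , v = ⊓⁻ (binaryˢ k) (unaryˢ j) h' in
        fact⁺ i j g (snoc (here (unaryˢ⁻ i g u)) (binaryˢ⁻ k g b) (unaryˢ⁻ j g v))
    where
    i = inject₁ k
    j = fsuc k
    F≤ : State.ar (unaryˢ i ⊓ (binaryˢ k ⊓ unaryˢ j)) ≤ 4
    F≤ = ℕ.≤-reflexive (cong₂ _+_ (unary-ar i) (cong₂ _+_ (binary-ar k) (unary-ar j)))

  module _ {e : Mat} (e·e : e · e ≡ e) {w : ℕ} where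

    open Idempotent e·e

    DLink : Var 𝔸 P → Var 𝔸 P → Set
    DLink x y = D w x y × col x y ≡ e

    link : ∀ {x y} → DLink x y → Link x y
    link ((le , _) , eq) = le , eq

    -- The chain may be a proper prefix of the word, as the symmetry argument needs only `l` links;
    -- words with fewer links are composed one by one.
    short-or-chain : ∀ l {i k} → Star DLink i k → D (w + l * 4) i k ⊎ (∃ λ j → Chain Link l i j)
    short-or-chain zero ws = inj₂ (_ , [])
    short-or-chain (suc l) ε = inj₁ D-unit
    short-or-chain (suc l) (h ◅ ws) with short-or-chain l ws
    ... | inj₁ p = inj₁ (D-mono (ℕ.≤-reflexive (eq w (l * 4))) (D-comp (D-mono (ℕ.m≤m+n w _) (proj₁ h)) p))
      where
      eq : ∀ a b → 4 + (a + b) ≡ a + (4 + b)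
      eq a b = trans (sym (ℕ.+-assoc 4 a b)) (trans (cong (_+ b) (ℕ.+-comm 4 a)) (ℕ.+-assoc a 4 b))
    ... | inj₂ (_ , ch) = inj₂ (_ , link h ∷ ch)

    -- The facts for (o, x) and (o, y) are equivalent modulo the links around x and y, so the far end
    -- moves along the chain without growing cost; the last link has no successor and is composed instead.
    slide : Symmetric → ∀ {o t x k} → Link o x → Avail (16 + w) (fact o x) → DLink t x → Star DLink x k → D (10 + w) o k
    slide sy l h _ ε = proj₁ l , avail-mono (lift 20 (ℕ.m≤m+n 16 4)) h
    -- The budget `16 + w` is the offset 10 plus `6 + w`, to which one composition adds 4.
    slide sy {o} {t} {x} l h tx (((x≤y , f) , _) ◅ ε) =
      D-comp {6 + w} (proj₁ l , h) (D-mono (ℕ.m≤n+m w 6) (x≤y , f))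
    slide sy {o} {t} {x} l h tx@((_ , ftx) , _) (_◅_ {j = y} xy@((_ , fxy) , _) ws@(_◅_ {j = z} yz@((_ , fyz) , _) _)) =
      slide sy oy
        -- The three neighbouring facts cost `14 + w` and the fact being moved has width 2: the
        -- total `16 + w` is the budget already granted to it.
        (avail-equiv {F = fact t x ⊓ (fact x y ⊓ fact y z)} h
          (avail-⊓ {u = 14 + w} ftx
            (avail-⊓ {u = 12 + w} fxy fyz (lift 12 (ℕ.m≤m+n 10 2)) ℕ.≤-refl (small 12 (ℕ.m≤m+n 4 8)))
            (lift 14 (ℕ.m≤m+n 10 4)) ℕ.≤-refl (small 14 (ℕ.m≤m+n 6 8)))
          ℕ.≤-refl ℕ.≤-refl ℕ.≤-refl (small 16 (ℕ.m≤m+n 10 6))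
          (λ g f p → let _ , f' = ⊓⁻ (fact t x) (fact x y ⊓ fact y z) f; b , _ = ⊓⁻ (fact x y) (fact y z) f' in
            fact⁺ o y g (reach-trans (fact⁻ o x g p) (fact⁻ x y g b)))
          (λ g f p → let a , f' = ⊓⁻ (fact t x) (fact x y ⊓ fact y z) f; b , c = ⊓⁻ (fact x y) (fact y z) f' in
            fact⁺ o x g (reach-back sy l oy (link tx) (link xy) (link yz)
              (fact⁻ t x g a) (fact⁻ x y g b) (fact⁻ y z g c) (fact⁻ o y g p))))
        xy ws
      where
      oy = link-chain l (link xy ∷ [])

    -- If at least `n` links follow the first, `e` is symmetric and the fact of the first link
    -- slides to the far end; otherwise the links are composed in turn.
    D-idem : ∀ {i k} → Star DLink i k → D (chain-cost n w) i k
    D-idem ε = D-unit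
    D-idem (h ◅ ws) with short-or-chain n ws
    ... | inj₁ p = D-mono (ℕ.+-monoˡ-≤ (n * 4) (lift 20 (ℕ.m≤m+n 4 16)))
                     (D-comp (D-mono (ℕ.m≤m+n w _) (proj₁ h)) p)
    ... | inj₂ (_ , ch) = D-mono (ℕ.≤-trans (lift 20 (ℕ.m≤m+n 10 10)) (ℕ.m≤m+n _ (n * 4)))
                     (slide (chain-symmetric (link h) ch) (link h)
                       (avail-mono (lift 16 (ℕ.m≤m+n 10 6)) (proj₂ (proj₁ h))) h ws)

  open FactorizationForest _≟ᴹ_ _·_ ·-assoc (4 +_) (chain-cost n)

  model : Model
  model = record
    { Pt = Var 𝔸 P
    ; _≼_ = Fin._≤_
    ; ≼-trans = ℕ.≤-trans
    ; col = col
    ; col-comp = col-comp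
    ; D = D
    ; D⇒≼ = proj₁
    ; mono = D-mono
    ; unit = D-unit
    ; comp = D-comp
    ; idem = λ e·e ws → D-idem e·e ws
    }

  all-edges : ∀ j → Model.Word model (λ x → x ∈ matrices) 10 fzero j
  all-edges = <-weakInduction _ ε λ k ws →
    ws Star.◅◅ ((D-edge k , ∈-matrices _) ◅ ε)

-- The uniform bound and the theorem

module _ (n N : ℕ) where

  open Matrices N
  open FactorizationForest _≟ᴹ_ _·_ ·-assoc (4 +_) (chain-cost n)

  -- Taking the semigroup of all Boolean matrices, rather than those of one instance, makes the
  -- bound depend on `n` and `N` alone.
  matrix-words : Bounded (λ M → M ∈ matrices)
  matrix-words = factorization _ matrices ℕ.≤-refl (λ _ _ → ∈-matrices _)

head-of : ∀ {X : Set} {k} → 1 ≤ k → Vec X k → X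
head-of (s≤s _) (x ∷ _) = x

inhabited-or-empty : ∀ k → Fin k ⊎ ¬ Fin k
inhabited-or-empty zero    = inj₂ λ ()
inhabited-or-empty (suc _) = inj₁ fzero

theorem20 : (n N : ℕ) → Σ ℕ λ f →
    (𝔸 : Structure) → NPermutable 𝔸 n →
    (P : PathInstance 𝔸) → ¬ Satisfiable 𝔸 P →
    (∀ i → card 𝔸 P i ≤ N) →
    Program.DerivesGoal 𝔸 f P
-- The first 10 is the offset in `D`; the argument of `ψ` is the cost of a single edge.
theorem20 n N = 10 + ψ 10 , derive
  where
  ψ = proj₁ (matrix-words n N)

  module _ (𝔸 : Structure) (perm : NPermutable 𝔸 n) (P : PathInstance 𝔸)
    (unsat : ¬ Satisfiable 𝔸 P) (card≤ : ∀ i → card 𝔸 P i ≤ N) where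

    open Paths 𝔸 P
    open Derivations 𝔸 P (9 + ψ 10)
    open PathInstance P

    derive-inhabited : A → Program.DerivesGoal 𝔸 (10 + ψ 10) P
    derive-inhabited a₀ =
      goal (proj₂ (proj₂ (matrix-words n N) model (all-edges (fromℕ m)))) ℕ.≤-refl (ℕ.m≤m+n 2 _) λ where
        (a ∷ b ∷ []) → dec-false (reach? fzero (fromℕ m) a b) (unsat ∘ reach⇒satisfiable)
      where
      open Construction n N 𝔸 perm P card≤ a₀ (9 + ψ 10)

    -- Labelling needs an element of the domain. Over an empty domain any unary constraint is
    -- already a goal.
    derive-empty : ¬ A → Program.DerivesGoal 𝔸 (10 + ψ 10) P
    derive-empty empty =
      goal (avail-constraint (unary-con fzero)) ar≤ ar≤ λ v →
        contradiction (head-of (Structure.arity-pos 𝔸 _) v) empty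
      where
      ar≤ : Structure.arity 𝔸 (unary fzero) ≤ 10 + ψ 10
      ar≤ = ℕ.≤-trans (ℕ.≤-reflexive (unary-ar fzero)) (s≤s z≤n)

    derive : Program.DerivesGoal 𝔸 (10 + ψ 10) P
    derive with inhabited-or-empty (Structure.size 𝔸)
    ... | inj₁ a = derive-inhabited a
    ... | inj₂ empty = derive-empty empty
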